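{- Let $n\ge 1$ be an integer and let the edges of the complete graph $K_{4n}$ be coloured with two colours (black and red) so that the number of black edges equals the number of red edges. Then $K_{4n}$ has a perfect matching in which the number of black edges equals the number of red edges. -}

module Defs where

open import Data.Nat using (ℕ; _<_; _<?_; _*_)
open import Data.Bool using (Bool; true; false; T; _∧_)
open import Data.Fin using (Fin; toℕ)
open import Data.List using (List; length; filter; allFin; concatMap; _∷_; [])
open import Data.Product using (_×_; _,_; proj₁; proj₂)
open import Relation.Binary.PropositionalEquality using (_≡_; _≢_)
open import Relation.Nullary.Decidable using (does)

-- An edge of K_m is an unordered pair {i,j}, i ≠ j, represented uniquely
-- as an ordered pair (i , j) with toℕ i < toℕ j.
Edge : ℕ → Set
Edge m = Fin m × Fin m

edges : (m : ℕ) → List (Edge m)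
edges m = filter (λ e → toℕ (proj₁ e) <? toℕ (proj₂ e))
            (concatMap (λ i → Data.List.map (λ j → (i , j)) (allFin m)) (allFin m))

-- A 2-colouring of the edges of K_m: colour of edge {i,j} with i<j is c i j
-- (true = black, false = red). Values c i j with i ≥ j are irrelevant.
Colouring : ℕ → Set
Colouring m = Fin m → Fin m → Bool

isBlack : ∀ {m} → Colouring m → Edge m → Bool
isBlack c (i , j) = c i j

isRed : ∀ {m} → Colouring m → Edge m → Bool
isRed c (i , j) = Data.Bool.not (c i j)

countBy : ∀ {m} → (Edge m → Bool) → List (Edge m) → ℕ
countBy p es = length (Data.List.filter (λ e → Data.Bool._≟_ (p e) true) es)

record PerfectMatching (m : ℕ) : Set where
  field
    partner    : Fin m → Fin m
    involutive : ∀ i → partner (partner i) ≡ i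
    noFixed    : ∀ i → partner i ≢ i

matchingEdges : ∀ {m} → PerfectMatching m → List (Edge m)
matchingEdges {m} M =
  filter (λ e → toℕ (proj₁ e) <? toℕ (proj₂ e))
    (Data.List.map (λ i → (i , PerfectMatching.partner M i)) (allFin m))

{-# OPTIONS --safe #-}
module Submission where

open import Defs
open import Data.Bool using (Bool; true; false; not; if_then_else_)
open import Data.Empty using (⊥-elim)
open import Data.Fin using (Fin; toℕ)
open import Data.Fin.Properties using (_≟_; toℕ-injective)
open import Data.List using (List; []; _∷_; _++_; length; map; filter; concatMap; allFin)
open import Data.List.Properties using (map-cong; map-cong-local; map-++; map-∘; ++-identityʳ; length-tabulate)
open import Data.List.Membership.Propositional using (_∈_)
open import Data.List.Membership.Propositional.Properties using (∈-allFin)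
open import Data.List.Relation.Binary.Permutation.Propositional using (_↭_; refl; prep; swap; trans; ↭-sym; ↭-trans; ↭-reflexive; ↭⇒↭ₛ)
open import Data.List.Relation.Binary.Permutation.Propositional.Properties using (map⁺; shift; shifts; ↭-length; ∈-resp-↭)
import Data.List.Relation.Binary.Permutation.Setoid.Properties as PermutationSetoid
open import Data.List.Relation.Unary.All as All using (All; []; _∷_)
open import Data.List.Relation.Unary.AllPairs using ([]; _∷_)
open import Data.List.Relation.Unary.Any using (here; there)
open import Data.List.Relation.Unary.Unique.Propositional using (Unique)
open import Data.List.Relation.Unary.Unique.Propositional.Properties using (allFin⁺)
open import Data.Nat using (ℕ; zero; suc; _+_; _*_; _∸_; _≤_; _<_; _<?_; _≤?_; _<ᵇ_; z≤n; s≤s)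
open import Data.Nat.Divisibility using (_∣_; divides; ∣m∣n⇒∣m+n; ∣m+n∣m⇒∣n; ∣1⇒≡1; m∣m*n; _∣0)
open import Data.Nat.ListAction using (sum)
open import Data.Nat.ListAction.Properties using (sum-++; sum-↭)
open import Data.Nat.Properties hiding (_≟_; _<?_; _≤?_)
open import Data.Nat.Tactic.RingSolver using (solve-∀)
open import Data.Product using (Σ; _×_; _,_; ∃-syntax; proj₁; proj₂)
open import Data.Sum using (_⊎_; inj₁; inj₂)
open import Relation.Binary.PropositionalEquality as ≡ using (_≡_; _≢_; refl; sym; cong; cong₂; subst)
open import Relation.Nullary using (¬_; yes; no)
open import Relation.Nullary.Reflects using (ofʸ; ofⁿ)

-- Put N = suc n. If no switch (replacing matching edges ab, xy by ax, by or by
-- ay, bx) increases the number of black edges of a perfect matching, summing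
-- over all pairs of its edges shows that it has at least the average number N
-- of black edges. So, up to exchanging the colours, we may start below N and
-- switch upwards, each time gaining one or two black edges, until N is reached
-- or a switch on a quadruple a, b, x, y jumps from N - 1 to N + 1. In the latter
-- case parity decides: unless one further switch attains N, the number of black
-- edges between any two common edges of the two matchings is even, as is the
-- number inside the quadruple and the number between it and each common edge.
-- The total number N (4 N - 1) of black edges would then have the parity of the
-- N - 1 black common edges, which is false.

-- Arithmetic and parity of small numbers.

+-interchange : ∀ a b c d → (a + b) + (c + d) ≡ (a + c) + (b + d)
+-interchange = solve-∀

sum-map-+ : {A : Set} (f g : A → ℕ) (l : List A) →
  sum (map (λ x → f x + g x) l) ≡ sum (map f l) + sum (map g l)
sum-map-+ f g []      = refl
sum-map-+ f g (x ∷ l) = ≡.trans (cong (f x + g x +_) (sum-map-+ f g l))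
  (+-interchange (f x) (g x) (sum (map f l)) (sum (map g l)))

+-≡0 : ∀ {m n} → m + n ≡ 0 → m ≡ 0 × n ≡ 0
+-≡0 {m} {n} eq = m+n≡0⇒m≡0 m eq , m+n≡0⇒n≡0 m eq

+-≡2 : ∀ {m n} → m ≤ 1 → n ≤ 1 → m + n ≡ 2 → m ≡ 1 × n ≡ 1
+-≡2 (s≤s z≤n) (s≤s z≤n) _ = refl , refl
+-≡2 z≤n       (s≤s z≤n) ()

2∣n+n : ∀ n → 2 ∣ n + n
2∣n+n n = divides n (≡.trans (cong (n +_) (sym (+-identityʳ n))) (*-comm 2 n))

increase≤2 : ∀ {s r} → s < r → r ≤ 2 → r ≡ suc s ⊎ (s ≡ 0 × r ≡ 2)
increase≤2 {0} (s≤s z≤n) (s≤s z≤n)             = inj₁ refl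
increase≤2 {0} (s≤s z≤n) (s≤s (s≤s z≤n))       = inj₂ (refl , refl)
increase≤2 {1} (s≤s (s≤s z≤n)) (s≤s (s≤s z≤n)) = inj₁ refl
increase≤2 {suc (suc _)} (s≤s (s≤s ())) (s≤s (s≤s z≤n))

-- Two matchings of four vertices weigh at most 2 each: either their weights are consecutive, and
-- exchanging them moves the value by exactly one, or their parities agree.
adjacent-or-even : ∀ {r s} → r ≤ 2 → s ≤ 2 → r ≡ suc s ⊎ s ≡ suc r ⊎ 2 ∣ r + s
adjacent-or-even z≤n             z≤n             = inj₂ (inj₂ (divides 0 refl))
adjacent-or-even z≤n             (s≤s z≤n)       = inj₂ (inj₁ refl)
adjacent-or-even z≤n             (s≤s (s≤s z≤n)) = inj₂ (inj₂ (divides 1 refl))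
adjacent-or-even (s≤s z≤n)       z≤n             = inj₁ refl
adjacent-or-even (s≤s z≤n)       (s≤s z≤n)       = inj₂ (inj₂ (divides 1 refl))
adjacent-or-even (s≤s z≤n)       (s≤s (s≤s z≤n)) = inj₂ (inj₁ refl)
adjacent-or-even (s≤s (s≤s z≤n)) z≤n             = inj₂ (inj₂ (divides 1 refl))
adjacent-or-even (s≤s (s≤s z≤n)) (s≤s z≤n)       = inj₁ refl
adjacent-or-even (s≤s (s≤s z≤n)) (s≤s (s≤s z≤n)) = inj₂ (inj₂ (divides 2 refl))

one-or-even : ∀ {r} → r ≤ 2 → r ≡ 1 ⊎ 2 ∣ r
one-or-even z≤n             = inj₂ (divides 0 refl)
one-or-even (s≤s z≤n)       = inj₁ refl
one-or-even (s≤s (s≤s z≤n)) = inj₂ (divides 1 refl)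

-- Here `G` is the goal: wherever a parity claim fails, a matching attaining the target is supplied
-- instead, and such an escape is passed through.
either₂ : {G A B C : Set} → (A → B → C) → G ⊎ A → G ⊎ B → G ⊎ C
either₂ f (inj₁ g) _        = inj₁ g
either₂ f (inj₂ _) (inj₁ g) = inj₁ g
either₂ f (inj₂ a) (inj₂ b) = inj₂ (f a b)

-- Matchings as lists of pairs

endpoints : {A : Set} → List (A × A) → List A
endpoints []             = []
endpoints ((a , b) ∷ ps) = a ∷ b ∷ endpoints ps

endpoints-↭ : {A : Set} {ps qs : List (A × A)} → ps ↭ qs → endpoints ps ↭ endpoints qs
endpoints-↭ refl        = refl
endpoints-↭ (prep e p)  = prep _ (prep _ (endpoints-↭ p))
endpoints-↭ (trans p q) = trans (endpoints-↭ p) (endpoints-↭ q)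
endpoints-↭ (swap (a , b) (x , y) p) = trans (shifts (a ∷ b ∷ []) (x ∷ y ∷ []))
  (prep x (prep y (prep a (prep b (endpoints-↭ p)))))

length-endpoints : {A : Set} (ps : List (A × A)) → length (endpoints ps) ≡ 2 * length ps
length-endpoints []       = refl
length-endpoints (_ ∷ ps) = ≡.trans (cong (λ k → suc (suc k)) (length-endpoints ps))
                                    (sym (*-suc 2 (length ps)))

pairing : {A : Set} (k : ℕ) (l : List A) → length l ≡ 2 * k → ∃[ ps ] endpoints ps ≡ l
pairing zero    []          _  = [] , refl
pairing (suc k) (a ∷ [])    eq with () ← ≡.trans eq (*-suc 2 k)
pairing (suc k) (a ∷ b ∷ l) eq with ps , refl ← pairing k l (suc-injective (suc-injective (≡.trans eq (*-suc 2 k)))) =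
  (a , b) ∷ ps , refl

module _ {A : Set} where

  swap₂₃ : ∀ {a b x y : A} {l} → a ∷ x ∷ b ∷ y ∷ l ↭ a ∷ b ∷ x ∷ y ∷ l
  swap₂₃ = prep _ (swap _ _ refl)

  rotate₂₃₄ : ∀ {a b x y : A} {l} → a ∷ y ∷ b ∷ x ∷ l ↭ a ∷ b ∷ x ∷ y ∷ l
  rotate₂₃₄ = prep _ (trans (swap _ _ refl) (prep _ (swap _ _ refl)))

-- Edge weights are split into halves h x y and h y x so that the total weight is
-- a plain double sum, which is visibly invariant under permutation of the vertices.
module Weighted {A : Set} (h : A → A → ℕ)
  (h-irrefl : ∀ x → h x x ≡ 0) (w≤1 : ∀ x y → h x y + h y x ≤ 1) where

  w : A → A → ℕ
  w x y = h x y + h y x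

  w-sym : ∀ x y → w x y ≡ w y x
  w-sym x y = +-comm (h x y) (h y x)

  w+w≤2 : ∀ a b x y → w a b + w x y ≤ 2
  w+w≤2 a b x y = +-mono-≤ (w≤1 a b) (w≤1 x y)

  -- Total weight and its decomposition along a matching.

  total : List A → ℕ
  total l = sum (map (λ x → sum (map (h x) l)) l)

  total-∷ : ∀ x l → total (x ∷ l) ≡ sum (map (w x) l) + total l
  total-∷ x l
    rewrite h-irrefl x
          | sum-map-+ (λ y → h y x) (λ y → sum (map (h y) l)) l
          | sum-map-+ (h x) (λ y → h y x) l
    = sym (+-assoc (sum (map (h x) l)) _ _)

  total-↭ : ∀ {l l'} → l ↭ l' → total l ≡ total l'
  total-↭ {l} {l'} p = ≡.trans (sum-↭ (map⁺ _ p))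
    (cong sum (map-cong (λ x → sum-↭ (map⁺ (h x) p)) l'))

  edge : A × A → ℕ
  edge (a , b) = w a b

  value : List (A × A) → ℕ
  value ps = sum (map edge ps)

  value-↭ : ∀ {ps qs} → ps ↭ qs → value ps ≡ value qs
  value-↭ p = sum-↭ (map⁺ edge p)

  -- The four edges between two pairs, grouped into the two matchings that a switch can put in place
  -- of the pairs.
  cross : A × A → A × A → ℕ
  cross (a , b) (x , y) = (w a x + w b y) + (w a y + w b x)

  crosses : A × A → List (A × A) → ℕ
  crosses e ps = sum (map (cross e) ps)

  pairTotal : List (A × A) → ℕ
  pairTotal []       = 0
  pairTotal (e ∷ ps) = (edge e + crosses e ps) + pairTotal ps

  rows≡crosses : ∀ a b ps →
    sum (map (w a) (endpoints ps)) + sum (map (w b) (endpoints ps)) ≡ crosses (a , b) ps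
  rows≡crosses a b []             = refl
  rows≡crosses a b ((x , y) ∷ ps) = ≡.trans
    (regroup (w a x) (w a y) (w b x) (w b y) (sum (map (w a) (endpoints ps))) (sum (map (w b) (endpoints ps))))
    (cong (cross (a , b) (x , y) +_) (rows≡crosses a b ps))
    where
    regroup : ∀ p q r s m n → (p + (q + m)) + (r + (s + n)) ≡ ((p + s) + (q + r)) + (m + n)
    regroup = solve-∀

  total-endpoints : ∀ ps → total (endpoints ps) ≡ pairTotal ps
  total-endpoints []             = refl
  total-endpoints ((a , b) ∷ ps)
    rewrite total-∷ a (b ∷ endpoints ps) | total-∷ b (endpoints ps)
          | total-endpoints ps | sym (rows≡crosses a b ps)
    = regroup (w a b) (sum (map (w a) (endpoints ps))) (sum (map (w b) (endpoints ps))) (pairTotal ps)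
    where
    regroup : ∀ p m n t → (p + m) + (n + t) ≡ (p + (m + n)) + t
    regroup = solve-∀

  -- Switches and local maximality.

  infix 4 _≃_
  -- Coarser than equality of matchings: only the vertices covered and the value are kept, so pairs
  -- may be reordered and reversed.
  _≃_ : List (A × A) → List (A × A) → Set
  ps ≃ qs = endpoints ps ↭ endpoints qs × value ps ≡ value qs

  ↭⇒≃ : ∀ {ps qs} → ps ↭ qs → ps ≃ qs
  ↭⇒≃ p = endpoints-↭ p , value-↭ p

  ≃-trans : ∀ {ps qs rs} → ps ≃ qs → qs ≃ rs → ps ≃ rs
  ≃-trans (p , u) (q , v) = ↭-trans p q , ≡.trans u v

  ≃-flip₂ : ∀ e {x y ps} → e ∷ (y , x) ∷ ps ≃ e ∷ (x , y) ∷ ps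
  ≃-flip₂ (a , b) {x} {y} {ps} = prep a (prep b (swap y x refl))
    , cong (λ k → w a b + (k + value ps)) (w-sym y x)

  -- The representative puts the two pairs to be switched in front; reversing `(x , y)` accounts for
  -- the other switch.
  Improvable : List (A × A) → Set
  Improvable ps = ∃[ a ] ∃[ b ] ∃[ x ] ∃[ y ] ∃[ rest ]
    (a , b) ∷ (x , y) ∷ rest ≃ ps × w a b + w x y < w a x + w b y

  Improvable-↭ : ∀ {ps qs} → ps ↭ qs → Improvable ps → Improvable qs
  Improvable-↭ p (a , b , x , y , rest , q , inc) =
    a , b , x , y , rest , ≃-trans q (↭⇒≃ p) , inc

  improve-pair : ∀ a b x y ps → Improvable ((a , b) ∷ (x , y) ∷ ps)
    ⊎ cross (a , b) (x , y) ≤ (w a b + w x y) + (w a b + w x y)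
  improve-pair a b x y ps
    with w a x + w b y ≤? w a b + w x y | w a y + w b x ≤? w a b + w x y
  ... | no ¬p | _     = inj₁ (a , b , x , y , ps , (refl , refl) , ≰⇒> ¬p)
  ... | yes p | yes q = inj₂ (+-mono-≤ p q)
  ... | yes p | no ¬q = inj₁ (a , b , y , x , ps , ≃-flip₂ (a , b)
        , subst (λ k → w a b + k < w a y + w b x) (w-sym x y) (≰⇒> ¬q))

  -- `ctx` carries the remaining pairs, so that a gain found in the row is a gain of the whole
  -- matching. Without one, the bounds of `improve-pair` are summed over `ps`.
  improve-row : ∀ e ps ctx → Improvable (e ∷ ps ++ ctx)
    ⊎ crosses e ps ≤ 2 * (length ps * edge e + value ps)
  improve-row e []       ctx = inj₂ z≤n
  improve-row e@(a , b) (g@(x , y) ∷ ps) ctx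
    with improve-pair a b x y (ps ++ ctx) | improve-row e ps (g ∷ ctx)
  ... | inj₁ i | _      = inj₁ i
  ... | inj₂ _ | inj₁ i = inj₁ (Improvable-↭ (prep e (shift g ps ctx)) i)
  ... | inj₂ p | inj₂ q = inj₂ (≤-trans (+-mono-≤ p q)
        (≤-reflexive (regroup (w a b) (w x y) (length ps) (value ps))))
    where
    regroup : ∀ p q l v → ((p + q) + (p + q)) + 2 * (l * p + v) ≡ 2 * ((p + l * p) + (q + v))
    regroup = solve-∀

  -- A matching that no switch improves is at least as heavy as the average perfect matching.
  improve-within : ∀ ps ctx → Improvable (ps ++ ctx)
    ⊎ pairTotal ps + value ps ≤ 2 * (length ps * value ps)
  improve-within []       ctx = inj₂ z≤n
  improve-within (e ∷ ps) ctx
    with improve-row e ps ctx | improve-within ps (e ∷ ctx)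
  ... | inj₁ i | _      = inj₁ i
  ... | inj₂ _ | inj₁ i = inj₁ (Improvable-↭ (shift e ps ctx) i)
  ... | inj₂ p | inj₂ q = inj₂ (begin
      ((edge e + crosses e ps) + pairTotal ps) + (edge e + value ps)
        ≡⟨ regroup₁ (edge e) (crosses e ps) (pairTotal ps) (value ps) ⟩
      (2 * edge e + crosses e ps) + (pairTotal ps + value ps)
        ≤⟨ +-mono-≤ (+-monoʳ-≤ (2 * edge e) p) q ⟩
      (2 * edge e + 2 * (length ps * edge e + value ps)) + 2 * (length ps * value ps)
        ≡⟨ regroup₂ (edge e) (length ps) (value ps) ⟩
      2 * (suc (length ps) * (edge e + value ps)) ∎)
    where
    open ≤-Reasoning
    regroup₁ : ∀ p c t v → ((p + c) + t) + (p + v) ≡ (2 * p + c) + (t + v)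
    regroup₁ = solve-∀
    regroup₂ : ∀ p l v → (2 * p + 2 * (l * p + v)) + 2 * (l * v) ≡ 2 * (suc l * (p + v))
    regroup₂ = solve-∀

  -- For `k` pairs the bound says that the total is at most `2k - 1` times the value; `value ps` is
  -- added on both sides to avoid subtraction.
  improve : ∀ ps → Improvable ps ⊎ pairTotal ps + value ps ≤ 2 * (length ps * value ps)
  improve ps with improve-within ps []
  ... | inj₁ i = inj₁ (subst Improvable (++-identityʳ ps) i)
  ... | inj₂ p = inj₂ p

  -- Attaining a prescribed value: the parity argument and the climb.

  Attains : List A → ℕ → Set
  Attains l k = ∃[ qs ] endpoints qs ↭ l × value qs ≡ k

  Attains-↭ : ∀ {l l' k} → l ↭ l' → Attains l k → Attains l' k
  Attains-↭ p (qs , q , v) = qs , ↭-trans q p , v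

  -- The switch jumps over the value 1 + value rest.
  module Jump (a b x y : A) (rest : List (A × A))
    (low : w a b + w x y ≡ 0) (high : w a x + w b y ≡ 2) where

    start : List (A × A)
    start = (a , b) ∷ (x , y) ∷ rest

    Hit : Set
    Hit = Attains (endpoints start) (suc (value rest))

    wab≡0 : w a b ≡ 0
    wab≡0 = proj₁ (+-≡0 low)

    wxy≡0 : w x y ≡ 0
    wxy≡0 = proj₂ (+-≡0 {w a b} low)

    wax≡1 : w a x ≡ 1
    wax≡1 = proj₁ (+-≡2 (w≤1 a x) (w≤1 b y) high)

    wby≡1 : w b y ≡ 1
    wby≡1 = proj₂ (+-≡2 (w≤1 a x) (w≤1 b y) high)

    regroup : ∀ i j k l m → i + (j + (k + (l + m))) ≡ (i + j) + ((k + l) + m)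
    regroup = solve-∀

    -- Suppose that replacing `uv`, `st` by `us`, `vt` changes the weight by one. A gain is combined
    -- with the light pairs `ab`, `xy`, a loss with the heavy pairs `ax`, `by`; both land on the
    -- skipped value.
    switch-parity : ∀ u v s t ps → (u , v) ∷ (s , t) ∷ ps ≃ rest →
      Hit ⊎ 2 ∣ (w u s + w v t) + (w u v + w s t)
    switch-parity u v s t ps (perm , val)
      with adjacent-or-even (w+w≤2 u s v t) (w+w≤2 u v s t)
    ... | inj₁ eq = inj₁ ((a , b) ∷ (x , y) ∷ (u , s) ∷ (v , t) ∷ ps
          , prep a (prep b (prep x (prep y (trans swap₂₃ perm))))
          , ≡.trans (regroup (w a b) (w x y) (w u s) (w v t) (value ps))
              (≡.trans (cong₂ (λ i j → i + (j + value ps)) low eq)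
                (cong suc (≡.trans (+-assoc (w u v) _ _) val))))
    ... | inj₂ (inj₁ eq) = inj₁ ((a , x) ∷ (b , y) ∷ (u , s) ∷ (v , t) ∷ ps
          , trans swap₂₃ (prep a (prep b (prep x (prep y (trans swap₂₃ perm)))))
          , ≡.trans (regroup (w a x) (w b y) (w u s) (w v t) (value ps))
              (≡.trans (cong (_+ ((w u s + w v t) + value ps)) high)
                (cong suc (≡.trans (cong (_+ value ps) (sym eq))
                  (≡.trans (+-assoc (w u v) _ _) val)))))
    ... | inj₂ (inj₂ even) = inj₂ even

    -- Both switches of the two pairs agree in parity with the current weight of the pairs, which
    -- cancels from the sum of the two.
    cross-even : ∀ e g ps → e ∷ g ∷ ps ↭ rest → Hit ⊎ 2 ∣ cross e g
    cross-even (u , v) (s , t) ps p = either₂ combine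
      (switch-parity u v s t ps (↭⇒≃ p))
      (switch-parity u v t s ps (≃-trans (≃-flip₂ (u , v)) (↭⇒≃ p)))
      where
      combine : 2 ∣ (w u s + w v t) + (w u v + w s t) →
                2 ∣ (w u t + w v s) + (w u v + w t s) → 2 ∣ cross (u , v) (s , t)
      combine p q rewrite w-sym t s = ∣m+n∣m⇒∣n
        (subst (2 ∣_) (rearrange (w u s + w v t) (w u t + w v s) (w u v + w s t)) (∣m∣n⇒∣m+n p q))
        (2∣n+n (w u v + w s t))
        where
        rearrange : ∀ r r' m → (r + m) + (r' + m) ≡ (m + m) + (r + r')
        rearrange = solve-∀

    crosses-even : ∀ e ps ctx → e ∷ ps ++ ctx ↭ rest → Hit ⊎ 2 ∣ crosses e ps
    crosses-even e []       ctx p = inj₂ (2 ∣0)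
    crosses-even e (g ∷ ps) ctx p = either₂ ∣m∣n⇒∣m+n
      (cross-even e g (ps ++ ctx) p)
      (crosses-even e ps (g ∷ ctx) (trans (prep e (shift g ps ctx)) p))

    -- All crosses are even, so only the matching edges count modulo 2, and `value ps` counts them a
    -- second time.
    pairTotal-parity : ∀ ps ctx → ps ++ ctx ↭ rest → Hit ⊎ 2 ∣ pairTotal ps + value ps
    pairTotal-parity []       ctx p = inj₂ (2 ∣0)
    pairTotal-parity (e ∷ ps) ctx p = either₂ combine
      (crosses-even e ps ctx p)
      (pairTotal-parity ps (e ∷ ctx) (trans (shift e ps ctx) p))
      where
      combine : 2 ∣ crosses e ps → 2 ∣ pairTotal ps + value ps →
                2 ∣ pairTotal (e ∷ ps) + value (e ∷ ps)
      combine p q = subst (2 ∣_) (rearrange (edge e) (crosses e ps) (pairTotal ps) (value ps))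
        (∣m∣n⇒∣m+n (2∣n+n (edge e)) (∣m∣n⇒∣m+n p q))
        where
        rearrange : ∀ i c t v → (i + i) + (c + (t + v)) ≡ ((i + c) + t) + (i + v)
        rearrange = solve-∀

    -- The pair `p'q'` takes the place of the common edge `uv` at equal weight, and `pu`, `qv` match
    -- the other four vertices; if these two weigh one together, the target is attained.
    quad-half : ∀ p q p' q' u v ps →
      (∀ l → p ∷ q ∷ p' ∷ q' ∷ l ↭ a ∷ b ∷ x ∷ y ∷ l) →
      endpoints ((u , v) ∷ ps) ↭ endpoints rest → w p' q' + value ps ≡ value rest →
      Hit ⊎ 2 ∣ w p u + w q v
    quad-half p q p' q' u v ps quad perm val with one-or-even (w+w≤2 p u q v)
    ... | inj₂ even = inj₂ even
    ... | inj₁ eq   = inj₁ ((p , u) ∷ (q , v) ∷ (p' , q') ∷ ps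
          , trans swap₂₃ (trans (prep p (prep q (shifts (u ∷ v ∷ []) (p' ∷ q' ∷ []))))
              (trans (quad _) (prep a (prep b (prep x (prep y perm))))))
          , ≡.trans (sym (+-assoc (w p u) _ _)) (cong₂ _+_ eq val))

    quad-crosses : ∀ p q p' q' u v ps →
      (∀ l → p ∷ q ∷ p' ∷ q' ∷ l ↭ a ∷ b ∷ x ∷ y ∷ l) →
      (u , v) ∷ ps ↭ rest → w p q ≡ w u v → w p' q' ≡ w u v →
      Hit ⊎ 2 ∣ cross (p , q) (u , v) + cross (p' , q') (u , v)
    quad-crosses p q p' q' u v ps quad perm eq eq' = either₂ ∣m∣n⇒∣m+n
      (either₂ ∣m∣n⇒∣m+n
        (quad-half p q p' q' u v ps quad uv (value-of eq'))
        (quad-half p q p' q' v u ps quad vu (value-of eq')))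
      (either₂ ∣m∣n⇒∣m+n
        (quad-half p' q' p q u v ps quad' uv (value-of eq))
        (quad-half p' q' p q v u ps quad' vu (value-of eq)))
      where
      uv : endpoints ((u , v) ∷ ps) ↭ endpoints rest
      uv = endpoints-↭ perm
      vu : endpoints ((v , u) ∷ ps) ↭ endpoints rest
      vu = trans (swap v u refl) uv
      value-of : ∀ {i} → i ≡ w u v → i + value ps ≡ value rest
      value-of eq = ≡.trans (cong (_+ value ps) eq) (value-↭ perm)
      quad' : ∀ l → p' ∷ q' ∷ p ∷ q ∷ l ↭ a ∷ b ∷ x ∷ y ∷ l
      quad' l = trans (shifts (p' ∷ q' ∷ []) (p ∷ q ∷ [])) (quad l)

    -- The weight of `uv` selects the matching of the quadruple both of whose edges weigh the same:
    -- `ab`, `xy` for 0 and `ax`, `by` for 1. Either choice sums the same eight edges between the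
    -- quadruple and `uv`.
    quad-cross-even : ∀ g ps → g ∷ ps ↭ rest → Hit ⊎ 2 ∣ cross (a , b) g + cross (x , y) g
    quad-cross-even (u , v) ps perm with w u v in eq | w≤1 u v
    ... | 0 | _ = quad-crosses a b x y u v ps (λ _ → refl) perm
                    (≡.trans wab≡0 (sym eq)) (≡.trans wxy≡0 (sym eq))
    ... | 1 | _ = subst (λ k → Hit ⊎ 2 ∣ k)
                    (rearrange (w a u) (w x v) (w a v) (w x u) (w b u) (w y v) (w b v) (w y u))
                    (quad-crosses a x b y u v ps (λ _ → swap₂₃) perm
                      (≡.trans wax≡1 (sym eq)) (≡.trans wby≡1 (sym eq)))
      where
      rearrange : ∀ au xv av xu bu yv bv yu →
        ((au + xv) + (av + xu)) + ((bu + yv) + (bv + yu)) ≡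
        ((au + bv) + (av + bu)) + ((xu + yv) + (xv + yu))
      rearrange = solve-∀
    ... | suc (suc _) | s≤s ()

    quad-crosses-even : ∀ ps ctx → ps ++ ctx ↭ rest →
      Hit ⊎ 2 ∣ crosses (a , b) ps + crosses (x , y) ps
    quad-crosses-even []       ctx p = inj₂ (2 ∣0)
    quad-crosses-even (g ∷ ps) ctx p = either₂
      (λ m n → subst (2 ∣_) (rearrange (cross (a , b) g) (cross (x , y) g) _ _) (∣m∣n⇒∣m+n m n))
      (quad-cross-even g (ps ++ ctx) p)
      (quad-crosses-even ps (g ∷ ctx) (trans (shift g ps ctx) p))
      where
      rearrange : ∀ i j k l → (i + j) + (k + l) ≡ (i + k) + (j + l)
      rearrange = solve-∀

    -- The third matching of the quadruple: with weight one it would itself attain the skipped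
    -- value.
    diagonals-even : Hit ⊎ 2 ∣ w a y + w b x
    diagonals-even with one-or-even (w+w≤2 a y b x)
    ... | inj₂ even = inj₂ even
    ... | inj₁ eq   = inj₁ ((a , y) ∷ (b , x) ∷ rest , rotate₂₃₄
          , ≡.trans (sym (+-assoc (w a y) _ _)) (cong (_+ value rest) eq))

    start-parity : Hit ⊎ 2 ∣ pairTotal start + value rest
    start-parity = either₂ combine diagonals-even
      (either₂ ∣m∣n⇒∣m+n (quad-crosses-even rest [] rest++[])
                         (pairTotal-parity rest [] rest++[]))
      where
      rest++[] : rest ++ [] ↭ rest
      rest++[] = ↭-reflexive (++-identityʳ rest)
      rearrange : ∀ d c c' t v →
        2 + (d + ((c + c') + (t + v))) ≡ (0 + ((2 + d) + c) + ((0 + c') + t)) + v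
      rearrange = solve-∀
      combine : 2 ∣ w a y + w b x →
        2 ∣ (crosses (a , b) rest + crosses (x , y) rest) + (pairTotal rest + value rest) →
        2 ∣ pairTotal start + value rest
      -- Inside the quadruple, `ab` and `xy` contribute 0, `ax` and `by` contribute 2, and the
      -- diagonals are even.
      combine p q rewrite wab≡0 | wxy≡0 | high = subst (2 ∣_)
        (rearrange (w a y + w b x) (crosses (a , b) rest) (crosses (x , y) rest)
                   (pairTotal rest) (value rest))
        (∣m∣n⇒∣m+n (divides 1 refl) (∣m∣n⇒∣m+n p q))

    -- Without a hit, `start-parity` and the hypothesis make two consecutive numbers even.
    jump-hit : 2 ∣ total (endpoints start) + suc (value rest) → Hit
    jump-hit even with start-parity
    ... | inj₁ hit = hit
    ... | inj₂ p   = ⊥-elim (2≢1 (∣1⇒≡1 (∣m+n∣m⇒∣n (subst (2 ∣_) rearrange even) p)))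
      where
      2≢1 : 2 ≢ 1
      2≢1 ()
      rearrange : total (endpoints start) + suc (value rest) ≡ (pairTotal start + value rest) + 1
      rearrange = ≡.trans (cong (_+ suc (value rest)) (total-endpoints start))
        (≡.trans (+-suc _ _) (+-comm 1 _))

  -- A perfect matching weighs on average total / (2 (1 + L) - 1); average says that this is N.
  module Climb (N L : ℕ) (base : List A) (length-base : length base ≡ 2 * suc L)
    (average : total base + N ≡ 2 * (suc L * N)) where

    not-maximal : ∀ ps d → endpoints ps ↭ base → value ps + suc d ≡ N →
      ¬ (pairTotal ps + value ps ≤ 2 * (length ps * value ps))
    not-maximal ps d perm refl p = <⇒≱ (begin-strict
        -- Both sides are raised by `suc d + value ps`, so that `average`, with `N` equal to
        -- `value ps + suc d`, applies without subtraction.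
        2 * (suc L * value ps) + (suc d + value ps)
          <⟨ +-monoʳ-< (2 * (suc L * value ps)) (+-monoˡ-< (value ps) (m<m+n (suc d) (s≤s z≤n))) ⟩
        2 * (suc L * value ps) + ((suc d + (suc d + 2 * (L * suc d))) + value ps)
          ≡⟨ rearrange L (value ps) (suc d) ⟩
        2 * (suc L * (value ps + suc d)) + value ps
          ≡⟨ cong (_+ value ps) average ⟨
        (total base + (value ps + suc d)) + value ps
          ≡⟨ cong (λ t → t + _ + value ps) (≡.trans (total-↭ (↭-sym perm)) (total-endpoints ps)) ⟩
        (pairTotal ps + (value ps + suc d)) + value ps
          ≡⟨ rearrange' (pairTotal ps) (value ps) (suc d) ⟩
        (pairTotal ps + value ps) + (suc d + value ps) ∎)
      (+-monoˡ-≤ (suc d + value ps) (subst (λ l → pairTotal ps + value ps ≤ 2 * (l * value ps)) length-ps p))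
      where
      open ≤-Reasoning
      length-ps : length ps ≡ suc L
      length-ps = *-cancelˡ-≡ _ _ 2
        (≡.trans (sym (length-endpoints ps)) (≡.trans (↭-length perm) length-base))
      rearrange : ∀ l v d → 2 * (suc l * v) + ((d + (d + 2 * (l * d))) + v) ≡ 2 * (suc l * (v + d)) + v
      rearrange = solve-∀
      rearrange' : ∀ t v d → (t + (v + d)) + v ≡ (t + v) + (d + v)
      rearrange' = solve-∀

    -- Induction on the deficit `d`: while it is positive, `not-maximal` guarantees a switch with a
    -- gain of one or two.
    climb : ∀ d ps → endpoints ps ↭ base → value ps + d ≡ N → Attains base N
    climb zero    ps perm eq = ps , perm , ≡.trans (sym (+-identityʳ _)) eq
    climb (suc d) ps perm eq with improve ps
    ... | inj₂ p = ⊥-elim (not-maximal ps d perm eq p)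
    ... | inj₁ (a , b , x , y , rest , (q , val) , inc)
      with increase≤2 inc (w+w≤2 a x b y)
    ...   | inj₁ one = climb d ((a , x) ∷ (b , y) ∷ rest) (trans swap₂₃ (trans q perm))
              (begin
                (w a x + (w b y + value rest)) + d    ≡⟨ cong (_+ d) (+-assoc (w a x) _ _) ⟨
                ((w a x + w b y) + value rest) + d    ≡⟨ cong (λ i → i + value rest + d) one ⟩
                suc (((w a b + w x y) + value rest) + d) ≡⟨ +-suc _ d ⟨
                ((w a b + w x y) + value rest) + suc d   ≡⟨ cong (_+ suc d) (≡.trans (+-assoc (w a b) _ _) val) ⟩
                value ps + suc d                      ≡⟨ eq ⟩
                N ∎)
              where open ≡.≡-Reasoning
    ...   | inj₂ (low , high) with d
    -- The deficit was at least two, so a gain of two does not overshoot.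
    ...     | suc d = climb d ((a , x) ∷ (b , y) ∷ rest) (trans swap₂₃ (trans q perm))
              (begin
                (w a x + (w b y + value rest)) + d    ≡⟨ cong (_+ d) (+-assoc (w a x) _ _) ⟨
                ((w a x + w b y) + value rest) + d    ≡⟨ cong (λ i → i + value rest + d) high ⟩
                2 + (value rest + d)                  ≡⟨ ≡.trans (+-suc _ (suc d)) (cong suc (+-suc _ d)) ⟨
                value rest + suc (suc d)              ≡⟨ cong (λ i → i + value rest + suc (suc d)) low ⟨
                ((w a b + w x y) + value rest) + suc (suc d) ≡⟨ cong (_+ suc (suc d)) (≡.trans (+-assoc (w a b) _ _) val) ⟩
                value ps + suc (suc d)                ≡⟨ eq ⟩
                N ∎)
              where open ≡.≡-Reasoning
    -- The deficit is one, so the switch jumps from `N - 1` to `N + 1`; `average` makes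
    -- `total base + N` even, as `jump-hit` requires.
    ...     | zero = Attains-↭ (trans q perm)
              (subst (Attains _) N≡ (jump-hit (subst (2 ∣_) total≡ (m∣m*n (suc L * N)))))
              where
              open Jump a b x y rest low high
              N≡ : suc (value rest) ≡ N
              N≡ = ≡.trans (+-comm 1 _) (≡.trans (cong (_+ 1)
                (≡.trans (cong (_+ value rest) (sym low)) (≡.trans (+-assoc (w a b) _ _) val))) eq)
              total≡ : 2 * (suc L * N) ≡ total (endpoints start) + suc (value rest)
              total≡ = ≡.trans (sym average)
                (cong₂ _+_ (total-↭ (↭-sym (trans q perm))) (sym N≡))

-- The matching of K_m given by a list of pairs

Unique-resp-↭ : {A : Set} {l l' : List A} → l ↭ l' → Unique l → Unique l'
Unique-resp-↭ {A} p = PermutationSetoid.Unique-resp-↭ (≡.setoid A) (↭⇒↭ₛ p)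

module _ {m : ℕ} where

  partner : List (Edge m) → Fin m → Fin m
  -- A default value: in `toMatching` every vertex is covered by some pair.
  partner []             i = i
  partner ((a , b) ∷ ps) i with i ≟ a | i ≟ b
  ... | yes _ | _     = b
  ... | no _  | yes _ = a
  ... | no _  | no _  = partner ps i

  partner-fst : ∀ a b ps → partner ((a , b) ∷ ps) a ≡ b
  partner-fst a b ps with a ≟ a
  ... | yes _  = refl
  ... | no a≢a = ⊥-elim (a≢a refl)

  partner-snd : ∀ a b ps → a ≢ b → partner ((a , b) ∷ ps) b ≡ a
  partner-snd a b ps a≢b with b ≟ a | b ≟ b
  ... | yes b≡a | _       = ⊥-elim (a≢b (sym b≡a))
  ... | no _    | yes _   = refl
  ... | no _    | no b≢b  = ⊥-elim (b≢b refl)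

  partner-tail : ∀ {a b i} ps → a ≢ i → b ≢ i → partner ((a , b) ∷ ps) i ≡ partner ps i
  partner-tail {a} {b} {i} ps a≢i b≢i with i ≟ a | i ≟ b
  ... | yes i≡a | _       = ⊥-elim (a≢i (sym i≡a))
  ... | no _    | yes i≡b = ⊥-elim (b≢i (sym i≡b))
  ... | no _    | no _    = refl

  -- For `partner-involutive`: a partner found in the tail lies in the tail, so the second lookup
  -- passes over the head pair as well.
  partner-∈ : ∀ {i} ps → Unique (endpoints ps) → i ∈ endpoints ps → partner ps i ∈ endpoints ps
  partner-∈ ((a , b) ∷ ps) _ (here refl) rewrite partner-fst a b ps = there (here refl)
  partner-∈ ((a , b) ∷ ps) ((a≢b ∷ _) ∷ _) (there (here refl))
    rewrite partner-snd a b ps a≢b = here refl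
  partner-∈ ((a , b) ∷ ps) ((_ ∷ a∉) ∷ b∉ ∷ u) (there (there i∈))
    rewrite partner-tail ps (All.lookup a∉ i∈) (All.lookup b∉ i∈) =
    there (there (partner-∈ ps u i∈))

  partner-involutive : ∀ {i} ps → Unique (endpoints ps) → i ∈ endpoints ps →
    partner ps (partner ps i) ≡ i
  partner-involutive ((a , b) ∷ ps) ((a≢b ∷ _) ∷ _) (here refl)
    rewrite partner-fst a b ps = partner-snd a b ps a≢b
  partner-involutive ((a , b) ∷ ps) ((a≢b ∷ _) ∷ _) (there (here refl))
    rewrite partner-snd a b ps a≢b = partner-fst a b ps
  partner-involutive ((a , b) ∷ ps) ((_ ∷ a∉) ∷ b∉ ∷ u) (there (there i∈))
    rewrite partner-tail ps (All.lookup a∉ i∈) (All.lookup b∉ i∈)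
          | partner-tail ps (All.lookup a∉ (partner-∈ ps u i∈)) (All.lookup b∉ (partner-∈ ps u i∈)) =
    partner-involutive ps u i∈

  partner-noFixed : ∀ {i} ps → Unique (endpoints ps) → i ∈ endpoints ps → partner ps i ≢ i
  partner-noFixed ((a , b) ∷ ps) ((a≢b ∷ _) ∷ _) (here refl)
    rewrite partner-fst a b ps = λ b≡a → a≢b (sym b≡a)
  partner-noFixed ((a , b) ∷ ps) ((a≢b ∷ _) ∷ _) (there (here refl))
    rewrite partner-snd a b ps a≢b = a≢b
  partner-noFixed ((a , b) ∷ ps) ((_ ∷ a∉) ∷ b∉ ∷ u) (there (there i∈))
    rewrite partner-tail ps (All.lookup a∉ i∈) (All.lookup b∉ i∈) = partner-noFixed ps u i∈

  toMatching : (ps : List (Edge m)) → endpoints ps ↭ allFin m → PerfectMatching m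
  toMatching ps p = record
    { partner    = partner ps
    ; involutive = λ i → partner-involutive ps unique (covered i)
    ; noFixed    = λ i → partner-noFixed ps unique (covered i)
    }
    where
    unique : Unique (endpoints ps)
    unique = Unique-resp-↭ (↭-sym p) (allFin⁺ m)
    covered : ∀ i → i ∈ endpoints ps
    covered i = ∈-resp-↭ (↭-sym p) (∈-allFin i)

  -- Each pair is met once from either endpoint, which reunites the two halves of its weight.
  sum-partner : ∀ (h : Fin m → Fin m → ℕ) ps → Unique (endpoints ps) →
    sum (map (λ i → h i (partner ps i)) (endpoints ps)) ≡ sum (map (λ (a , b) → h a b + h b a) ps)
  sum-partner h []             _ = refl
  sum-partner h ((a , b) ∷ ps) ((a≢b ∷ a∉) ∷ b∉ ∷ u) = ≡.trans
    (cong₂ _+_ (cong (h a) (partner-fst a b ps))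
      (cong₂ _+_ (cong (h b) (partner-snd a b ps a≢b))
        (≡.trans
          (cong sum (map-cong-local (All.zipWith
            (λ {i} (a≢i , b≢i) → cong (h i) (partner-tail ps a≢i b≢i)) (a∉ , b∉))))
          (sum-partner h ps u))))
    (sym (+-assoc (h a b) (h b a) _))

-- Colour counts as sums

bit : Bool → ℕ
bit b = if b then 1 else 0

-- The red edges of `c` are by computation the black edges of `complement c`, so one black count
-- serves both colours.
complement : ∀ {m} → Colouring m → Colouring m
complement c i j = not (c i j)

-- The half weight `h`: a black edge is charged wholly to its smaller endpoint. The test `_<ᵇ_` is
-- what `_<?_` in the filters computes to.
blackUp : ∀ {m} → Colouring m → Fin m → Fin m → ℕ
blackUp c i j = if toℕ i <ᵇ toℕ j then bit (c i j) else 0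

blackUp-irrefl : ∀ {m} (c : Colouring m) i → blackUp c i i ≡ 0
blackUp-irrefl c i with toℕ i <ᵇ toℕ i | <ᵇ-reflects-< (toℕ i) (toℕ i)
... | true  | ofʸ i<i = ⊥-elim (<-irrefl refl i<i)
... | false | _       = refl

bit≤1 : ∀ b → bit b ≤ 1
bit≤1 true  = s≤s z≤n
bit≤1 false = z≤n

blackUp-≤1 : ∀ {m} (c : Colouring m) i j → blackUp c i j + blackUp c j i ≤ 1
blackUp-≤1 c i j 
  with toℕ i <ᵇ toℕ j | <ᵇ-reflects-< (toℕ i) (toℕ j) | toℕ j <ᵇ toℕ i | <ᵇ-reflects-< (toℕ j) (toℕ i)
... | true  | ofʸ i<j | true  | ofʸ j<i = ⊥-elim (<-asym i<j j<i)
... | true  | _       | false | _       = subst (_≤ 1) (sym (+-identityʳ _)) (bit≤1 (c i j))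
... | false | _       | true  | _       = bit≤1 (c j i)
... | false | _       | false | _       = z≤n

module Black {m : ℕ} (c : Colouring m) =
  Weighted (blackUp c) (blackUp-irrefl c) (blackUp-≤1 c)

-- A colouring and its complement.

bit+bit-not : ∀ b → bit b + bit (not b) ≡ 1
bit+bit-not true  = refl
bit+bit-not false = refl

w-complement : ∀ {m} (c : Colouring m) {i j} → i ≢ j →
  Black.w c i j + Black.w (complement c) i j ≡ 1
w-complement c {i} {j} i≢j 
  with toℕ i <ᵇ toℕ j | <ᵇ-reflects-< (toℕ i) (toℕ j) | toℕ j <ᵇ toℕ i | <ᵇ-reflects-< (toℕ j) (toℕ i)
... | true  | ofʸ i<j | true  | ofʸ j<i = ⊥-elim (<-asym i<j j<i)
... | true  | _       | false | _       = ≡.trans (cong₂ _+_ (+-identityʳ (bit (c i j))) (+-identityʳ _)) (bit+bit-not (c i j))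
... | false | _       | true  | _       = bit+bit-not (c j i)
... | false | ofⁿ i≮j | false | ofⁿ j≮i = ⊥-elim (i≢j (toℕ-injective (≤-antisym (≮⇒≥ j≮i) (≮⇒≥ i≮j))))

row-complement : ∀ {m} (c : Colouring m) i l → All (i ≢_) l →
  sum (map (Black.w c i) l) + sum (map (Black.w (complement c) i) l) ≡ length l
row-complement c i []      _            = refl
row-complement c i (j ∷ l) (i≢j ∷ rest) = ≡.trans
  (+-interchange (Black.w c i j) _ (Black.w (complement c) i j) _)
  (cong₂ _+_ (w-complement c i≢j) (row-complement c i l rest))

-- On `k` vertices the two colours share `k(k - 1)/2` edges; the equation avoids subtraction and
-- division.
total-complement : ∀ {m} (c : Colouring m) l → Unique l →
  2 * (Black.total c l + Black.total (complement c) l) + length l ≡ length l * length l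
total-complement c []      _        = refl
total-complement c (i ∷ l) (i∉ ∷ u)
  rewrite Black.total-∷ c i l | Black.total-∷ (complement c) i l = ≡.trans
    (rearrange (sum (map (Black.w c i) l)) (Black.total c l)
               (sum (map (Black.w (complement c) i) l)) (Black.total (complement c) l) (length l))
    (≡.trans
      (cong₂ (λ r t → suc (2 * r + t)) (row-complement c i l i∉) (total-complement c l u))
      (square (length l)))
  where
  rearrange : ∀ r t r' t' k →
    2 * ((r + t) + (r' + t')) + suc k ≡ suc (2 * (r + r') + (2 * (t + t') + k))
  rearrange = solve-∀
  square : ∀ k → suc (2 * k + k * k) ≡ suc k * suc k
  square = solve-∀

value-complement : ∀ {m} (c : Colouring m) ps → Unique (endpoints ps) →
  Black.value c ps + Black.value (complement c) ps ≡ length ps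
value-complement c []             _ = refl
value-complement c ((a , b) ∷ ps) ((a≢b ∷ _) ∷ _ ∷ u) = ≡.trans
  (+-interchange (Black.w c a b) _ (Black.w (complement c) a b) _)
  (cong₂ _+_ (w-complement c a≢b) (value-complement c ps u))

-- Translation of `countBy` into total weight and value.

countBy-filter : ∀ {m} (c : Colouring m) (es : List (Edge m)) →
  countBy (isBlack c) (filter (λ e → toℕ (proj₁ e) <? toℕ (proj₂ e)) es)
    ≡ sum (map (λ (i , j) → blackUp c i j) es)
countBy-filter c []             = refl
countBy-filter c ((i , j) ∷ es) with toℕ i <ᵇ toℕ j
... | false = countBy-filter c es
... | true with c i j
...   | true  = cong suc (countBy-filter c es)
...   | false = countBy-filter c es

sum-concatMap : {A B C : Set} (f : C → ℕ) (g : A → B → C) (l : List A) (l' : List B) →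
  sum (map f (concatMap (λ a → map (g a) l') l)) ≡ sum (map (λ a → sum (map (λ b → f (g a b)) l')) l)
sum-concatMap f g []      l' = refl
sum-concatMap f g (a ∷ l) l' = begin
  sum (map f (map (g a) l' ++ concatMap (λ a → map (g a) l') l))
    ≡⟨ cong sum (map-++ f (map (g a) l') _) ⟩
  sum (map f (map (g a) l') ++ map f (concatMap (λ a → map (g a) l') l))
    ≡⟨ sum-++ (map f (map (g a) l')) _ ⟩
  sum (map f (map (g a) l')) + sum (map f (concatMap (λ a → map (g a) l') l))
    ≡⟨ cong₂ _+_ (cong sum (sym (map-∘ l'))) (sum-concatMap f g l l') ⟩
  sum (map (λ b → f (g a b)) l') + sum (map (λ a → sum (map (λ b → f (g a b)) l')) l) ∎
  where open ≡.≡-Reasoning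

countBy-edges : ∀ {m} (c : Colouring m) →
  countBy (isBlack c) (edges m) ≡ Black.total c (allFin m)
countBy-edges {m} c = ≡.trans
  (countBy-filter c (concatMap (λ i → map (i ,_) (allFin m)) (allFin m)))
  (sum-concatMap (λ (i , j) → blackUp c i j) _,_ (allFin m) (allFin m))

countBy-matching : ∀ {m} (c : Colouring m) ps (p : endpoints ps ↭ allFin m) →
  countBy (isBlack c) (matchingEdges (toMatching ps p)) ≡ Black.value c ps
countBy-matching {m} c ps p = begin
  countBy (isBlack c) (matchingEdges (toMatching ps p))
    ≡⟨ countBy-filter c (map (λ i → i , partner ps i) (allFin m)) ⟩
  sum (map (λ (i , j) → blackUp c i j) (map (λ i → i , partner ps i) (allFin m)))
    ≡⟨ cong sum (map-∘ (allFin m)) ⟨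
  sum (map (λ i → blackUp c i (partner ps i)) (allFin m))
    ≡⟨ sum-↭ (map⁺ _ p) ⟨
  sum (map (λ i → blackUp c i (partner ps i)) (endpoints ps))
    ≡⟨ sum-partner (blackUp c) ps (Unique-resp-↭ (↭-sym p) (allFin⁺ m)) ⟩
  Black.value c ps ∎
  where open ≡.≡-Reasoning

-- Balanced colourings.

module Balanced (n : ℕ) (c : Colouring (4 * suc n))
  (balanced : Black.total c (allFin (4 * suc n)) ≡ Black.total (complement c) (allFin (4 * suc n))) where

  N : ℕ
  N = suc n

  base : List (Fin (4 * N))
  base = allFin (4 * N)

  length-base : length base ≡ 4 * N
  length-base = length-tabulate {n = 4 * N} (λ i → i)

  length-base′ : length base ≡ 2 * (2 * N)
  length-base′ = ≡.trans length-base (*-assoc 2 2 N)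

  -- Each colour has half of the `2N(4N - 1)` edges, and adding `N` gives `4N` times `N`.
  average : Black.total c base + N ≡ 2 * (2 * N * N)
  average = *-cancelˡ-≡ _ _ 4 (begin
    4 * (T + N)                   ≡⟨ rearrange T N ⟩
    2 * (T + T) + 4 * N           ≡⟨ cong (λ t → 2 * (T + t) + 4 * N) balanced ⟩
    2 * (T + T') + 4 * N          ≡⟨ cong (2 * (T + T') +_) length-base ⟨
    2 * (T + T') + length base    ≡⟨ total-complement c base (allFin⁺ _) ⟩
    length base * length base     ≡⟨ cong₂ _*_ length-base length-base ⟩
    (4 * N) * (4 * N)             ≡⟨ square N ⟩
    4 * (2 * (2 * N * N))         ∎)
    where
    open ≡.≡-Reasoning
    T T' : ℕ
    T  = Black.total c base
    T' = Black.total (complement c) base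
    rearrange : ∀ t k → 4 * (t + k) ≡ 2 * (t + t) + 4 * k
    rearrange = solve-∀
    square : ∀ k → (4 * k) * (4 * k) ≡ 4 * (2 * (2 * k * k))
    square = solve-∀

  value-sum : ∀ ps → endpoints ps ↭ base → Black.value c ps + Black.value (complement c) ps ≡ N + N
  value-sum ps p = ≡.trans (value-complement c ps (Unique-resp-↭ (↭-sym p) (allFin⁺ _)))
    (*-cancelˡ-≡ _ _ 2 (begin
      2 * length ps          ≡⟨ length-endpoints ps ⟨
      length (endpoints ps)  ≡⟨ ↭-length p ⟩
      length base            ≡⟨ length-base′ ⟩
      2 * (2 * N)            ≡⟨ cong (λ k → 2 * (N + k)) (+-identityʳ N) ⟩
      2 * (N + N)            ∎))
    where open ≡.≡-Reasoning

  climb-from : (c' : Colouring (4 * N)) → Black.total c' base + N ≡ 2 * (2 * N * N) →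
    ∀ ps → endpoints ps ↭ base → Black.value c' ps ≤ N → Black.Attains c' base N
  climb-from c' average' ps p v≤N =
    -- The choice of `L` makes `suc L` compute to `2 * N`, the number of pairs.
    Black.Climb.climb c' N (n + 1 * N) base length-base′ average' (N ∸ Black.value c' ps) ps p (m+[n∸m]≡n v≤N)

  -- A matching has `2N` edges, so some colour occurs at most `N` times in it; the climb in that
  -- colour ends at `N` and leaves `N` edges for the other.
  balanced-pairs : ∃[ ps ] endpoints ps ↭ base × Black.value c ps ≡ N × Black.value (complement c) ps ≡ N
  balanced-pairs with pairing (2 * N) base length-base′
  ... | ps , eq with ≤-total (Black.value c ps) N
  ...   | inj₁ v≤N with qs , q , v ← climb-from c average ps (↭-reflexive eq) v≤N =
      qs , q , v , +-cancelˡ-≡ N _ _ (≡.trans (cong (_+ Black.value (complement c) qs) (sym v)) (value-sum qs q))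
  ...   | inj₂ N≤v with qs , q , v ← climb-from (complement c) (≡.trans (cong (_+ N) (sym balanced)) average)
                                       ps (↭-reflexive eq) (+-cancelˡ-≤ N _ _
                                         (≤-trans (+-monoˡ-≤ _ N≤v) (≤-reflexive (value-sum ps (↭-reflexive eq))))) =
      qs , q , +-cancelʳ-≡ N _ _ (≡.trans (cong (Black.value c qs +_) (sym v)) (value-sum qs q)) , v

theorem2 : (n : ℕ) → (c : Colouring (4 * suc n))
    → countBy (isBlack c) (edges (4 * suc n)) ≡ countBy (isRed c) (edges (4 * suc n))
    → Σ (PerfectMatching (4 * suc n)) λ M
    → countBy (isBlack c) (matchingEdges M) ≡ countBy (isRed c) (matchingEdges M)
theorem2 n c eq with Balanced.balanced-pairs n c
    (≡.trans (sym (countBy-edges c)) (≡.trans eq (countBy-edges (complement c))))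
... | ps , p , black , red = toMatching ps p ,
  ≡.trans (countBy-matching c ps p)
    (≡.trans black (sym (≡.trans (countBy-matching (complement c) ps p) red)))
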